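{- Let $n\ge2$ and suppose that $I\subset[n-1]$ has cardinality $n-2$. Then $\mathrm{ASM}^I(n)=S_n^I$ (with permutations identified with their permutation matrices).
   Context: $[m]=\{1,\dots,m\}$. An alternating sign matrix (ASM) is a square matrix with entries in $\{0,1,-1\}$ such that the nonzero entries in each row and each column alternate in sign and each row and each column sums to $1$; $\mathrm{ASM}(n)$ is the set of $n\times n$ ASMs. The rank matrix of $A$ is $r_A(i,j)=\sum_{p=1}^i\sum_{q=1}^jA_{p,q}$, with $r_A(0,j)=r_A(i,0)=0$. $\mathrm{ASM}^I(n):=\{A\in\mathrm{ASM}(n)\mid r_A(i,j)\in\{r_A(i-1,j)+1,\ r_A(i+1,j)\}\text{ for all }i\in I,\ j\in[n]\}$. $S_n^I=\{w\in S_n\mid w(i)<w(i+1)\text{ for all }i\in I\}$, where $w\in S_n$ is identified with the permutation matrix having $1$'s in positions $(i,w(i))$. -}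

module Defs where

open import Data.Bool.Base using (if_then_else_)
open import Data.Fin.Base using (Fin; suc; inject₁; inject!; Fin′; _<_)
open import Data.Fin.Permutation using (Permutation′; _⟨$⟩ʳ_)
open import Data.Fin.Properties using (_≟_)
open import Data.Fin.Subset using (Subset; _∈_)
open import Data.Integer.Base using (ℤ; 0ℤ; 1ℤ; -1ℤ; _+_; sign)
import Data.Integer.Properties as ℤ
open import Data.List.Base using (filter)
open import Data.List.Relation.Unary.Linked using (Linked)
open import Data.Nat.Base using (ℕ; suc)
open import Data.Product.Base using (_×_)
open import Data.Sum.Base using (_⊎_)
open import Data.Vec.Functional using (Vector; toList; transpose)
open import Relation.Binary.PropositionalEquality.Core using (_≡_; _≢_)
open import Relation.Nullary.Decidable using (¬?; does)
open import Algebra.Properties.CommutativeMonoid.Sum ℤ.+-0-commutativeMonoid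
  using (sum)

SquareMatrix : ℕ → Set
SquareMatrix n = Vector (Vector ℤ n) n

infix 4 _≈ᴹ_

_≈ᴹ_ : ∀ {n} → SquareMatrix n → SquareMatrix n → Set
A ≈ᴹ B = ∀ p q → A p q ≡ B p q

-- Consecutive terms in the list of nonzero entries have different signs.
Alternating : ∀ {n} → Vector ℤ n → Set
Alternating v =
  Linked (λ x y → sign x ≢ sign y) (filter (λ x → ¬? (x ℤ.≟ 0ℤ)) (toList v))

record IsASM {n : ℕ} (A : SquareMatrix n) : Set where
  field
    entries     : ∀ p q → A p q ≡ 0ℤ ⊎ A p q ≡ 1ℤ ⊎ A p q ≡ -1ℤ
    rows-alt    : ∀ p → Alternating (A p)
    columns-alt : ∀ q → Alternating (transpose A q)
    rows-sum    : ∀ p → sum (A p) ≡ 1ℤ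
    columns-sum : ∀ q → sum (transpose A q) ≡ 1ℤ

-- Rank-matrix indices run over {0, …, n}: rank A i j is the sum of the
-- top-left block with toℕ i rows and toℕ j columns.
rank : ∀ {n} → SquareMatrix n → Fin (suc n) → Fin (suc n) → ℤ
rank A i j = sum λ (p : Fin′ i) → sum λ (q : Fin′ j) → A (inject! p) (inject! q)

-- Below n = suc m, and an element i of [n - 1] is represented by the
-- i : Fin m with 1 + toℕ i equal to it.  Hence the rank-matrix row indices
-- i - 1, i, i + 1 are, respectively, inject₁ (inject₁ i), suc (inject₁ i)
-- and suc (suc i), while rows i and i + 1 of the matrix are those at
-- inject₁ i and suc i.  Likewise the rank-matrix column index of
-- j : Fin n is suc j.

infix 4 _∈ASM^_ _∈S^_

_∈ASM^_ : ∀ {m} → SquareMatrix (suc m) → Subset m → Set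
_∈ASM^_ {m} A I = IsASM A × (∀ (i : Fin m) → i ∈ I → ∀ (j : Fin (suc m)) →
    rank A (suc (inject₁ i)) (suc j) ≡ rank A (inject₁ (inject₁ i)) (suc j) + 1ℤ
  ⊎ rank A (suc (inject₁ i)) (suc j) ≡ rank A (suc (suc i)) (suc j))

_∈S^_ : ∀ {m} → Permutation′ (suc m) → Subset m → Set
_∈S^_ {m} w I = ∀ (i : Fin m) → i ∈ I → w ⟨$⟩ʳ inject₁ i < w ⟨$⟩ʳ suc i

permutationMatrix : ∀ {n} → Permutation′ n → SquareMatrix n
permutationMatrix w p q = if does (w ⟨$⟩ʳ p ≟ q) then 1ℤ else 0ℤ

{-# OPTIONS --safe #-}
-- Write R p j for the sum of the first j entries of row p; in an ASM it is 0
-- or 1.  Cancelling ranks, the condition at i ∈ I says that R (i + 1) j = 1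
-- forces R i j = 1, i.e. a zero of R _ j persists from row i to row i + 1.
-- Only one index k is missing from I, so zeros persist within rows 1, …, k and
-- within rows k + 1, …, n.  Suppose A p q = -1.  Column q has a 1 both above
-- and below row p.  If p ≤ k, the 1 above, in row p′ say, gives
-- R p′ (q - 1) = 0, hence R p (q - 1) = 0, and R p q would be -1.  If p > k,
-- R p q = 0 persists to the 1 below, in whose row that prefix sum is 1.  So A
-- has no entry -1, which makes it a permutation matrix.
module Submission where

open import Defs
open import Data.Bool.Base using (Bool; true; false; if_then_else_)
open import Data.Fin.Base
  using (Fin; zero; suc; inject₁; inject!; Fin′; toℕ; _≤_; _<_)
open import Data.Fin.Induction using (<-weakInduction-startingFrom)
open import Data.Fin.Permutation
  using (Permutation′; permutation; _⟨$⟩ʳ_; _⟨$⟩ˡ_; inverseˡ; inverseʳ)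
open import Data.Fin.Properties as Fin using (_≟_; toℕ-inject₁; ≤̄⇒inject₁<)
open import Data.Fin.Subset using (Subset; ∣_∣; _∈_; inside; outside)
open import Data.Fin.Subset.Properties using (∣p∣≡n⇒p≡⊤; ∈⊤)
open import Data.Integer.Base using (ℤ; 0ℤ; 1ℤ; -1ℤ; _+_; sign)
import Data.Integer.Properties as ℤ
open import Algebra.Properties.AbelianGroup ℤ.+-0-abelianGroup using (∙-cancelˡ)
open import Algebra.Properties.CommutativeMonoid.Sum ℤ.+-0-commutativeMonoid
  using (sum; sum-cong-≗; sum-replicate-zero)
open import Data.List.Base using (List; []; _∷_; filter)
open import Data.List.Relation.Unary.Linked using (Linked; [-]; _∷_)
open import Data.Nat.Base using (ℕ; zero; suc; s≤s; z<s; s<s)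
import Data.Nat.Properties as ℕ
open import Data.Product.Base using (∃-syntax; _×_; _,_; proj₁; proj₂)
open import Data.Sum.Base using (_⊎_; inj₁; inj₂; [_,_]′)
open import Data.Vec.Base using (_∷_; here; there)
open import Data.Vec.Functional using (Vector; toList; tail; transpose)
open import Function.Base using (_∘_; id)
open import Function.Bundles using (_⇔_; mk⇔; module Injection)
open import Function.Properties.Inverse using (↔⇒↣)
open import Relation.Binary.PropositionalEquality
  using (_≡_; _≢_; refl; sym; trans; cong; cong₂; subst)
open import Relation.Nullary.Decidable using (yes; no; does; ¬?; does-⇔; dec-true)
open import Relation.Nullary.Negation using (contradiction)

-- Prefix sums and paths through 0 and 1.

prefix : ∀ {n} → Vector ℤ n → Fin (suc n) → ℤ
prefix v j = sum λ (q : Fin′ j) → v (inject! q)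

prefix-suc : ∀ {n} (v : Vector ℤ n) q →
  prefix v (suc q) ≡ prefix v (inject₁ q) + v q
prefix-suc v zero = ℤ.+-comm (v zero) 0ℤ
prefix-suc v (suc q) = trans (cong (v zero +_) (prefix-suc (tail v) q))
  (sym (ℤ.+-assoc (v zero) _ (v (suc q))))

⟦_⟧ : Bool → ℤ
⟦ b ⟧ = if b then 1ℤ else 0ℤ

-- The running sums of v, started at ⟦ s ⟧, stay in {0, 1} and end at ⟦ t ⟧.
data Path : ∀ {n} → Bool → Vector ℤ n → Bool → Set where
  done : ∀ {s} {v : Vector ℤ 0} → Path s v s
  step : ∀ {n s s′ t} {v : Vector ℤ (suc n)} →
    ⟦ s ⟧ + v zero ≡ ⟦ s′ ⟧ → Path s′ (tail v) t → Path s v t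

path-sum : ∀ {n s t} {v : Vector ℤ n} → Path s v t → ⟦ s ⟧ + sum v ≡ ⟦ t ⟧
path-sum {s = s} done = ℤ.+-identityʳ ⟦ s ⟧
path-sum {s = s} {v = v} (step eq π) =
  trans (sym (ℤ.+-assoc ⟦ s ⟧ (v zero) _))
    (trans (cong (_+ sum (tail v)) eq) (path-sum π))

path-prefix : ∀ {n s t} {v : Vector ℤ n} → Path s v t →
  ∀ j → ∃[ b ] ⟦ s ⟧ + prefix v j ≡ ⟦ b ⟧
path-prefix {s = s} π zero = s , ℤ.+-identityʳ ⟦ s ⟧
path-prefix {s = s} {v = v} (step eq π) (suc j) with path-prefix π j
... | b , eq′ = b , trans (sym (ℤ.+-assoc ⟦ s ⟧ (v zero) _))
    (trans (cong (_+ prefix (tail v) j) eq) eq′)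

path-prefix₀ : ∀ {n t} {v : Vector ℤ n} → Path false v t →
  ∀ j → ∃[ b ] prefix v j ≡ ⟦ b ⟧
path-prefix₀ π j with path-prefix π j
... | b , eq = b , trans (sym (ℤ.+-identityˡ _)) eq

-- Both running sums lie in {0, 1} and differ by 1, which leaves a single pair of values.
path-rise : ∀ {n t} {v : Vector ℤ n} → Path false v t → ∀ {q} → v q ≡ 1ℤ →
  prefix v (inject₁ q) ≡ 0ℤ × prefix v (suc q) ≡ 1ℤ
path-rise {v = v} π {q} eq
  with path-prefix₀ π (inject₁ q) | path-prefix₀ π (suc q) | prefix-suc v q
... | b , e | b′ , e′ | e″ rewrite e | e′ | eq with b | b′ | e″
... | false | true  | _ = refl , refl
... | false | false | ()
... | true  | true  | ()
... | true  | false | ()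

path-fall : ∀ {n t} {v : Vector ℤ n} → Path false v t → ∀ {q} → v q ≡ -1ℤ →
  prefix v (inject₁ q) ≡ 1ℤ × prefix v (suc q) ≡ 0ℤ
path-fall {v = v} π {q} eq
  with path-prefix₀ π (inject₁ q) | path-prefix₀ π (suc q) | prefix-suc v q
... | b , e | b′ , e′ | e″ rewrite e | e′ | eq with b | b′ | e″
... | true  | false | _ = refl , refl
... | true  | true  | ()
... | false | true  | ()
... | false | false | ()

path-one : ∀ {n} {v : Vector ℤ n} → Path false v true → ∃[ q ] v q ≡ 1ℤ
path-one {v = v} (step {s′ = true} eq π) =
  zero , trans (sym (ℤ.+-identityˡ _)) eq
path-one (step {s′ = false} eq π) with path-one π
... | q , eq′ = suc q , eq′

-- An entry -1 steps down from 1, so a path that starts at 0 has already climbed.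
one-before : ∀ {n t} {v : Vector ℤ n} → Path false v t → ∀ {q} → v q ≡ -1ℤ →
  ∃[ p ] p < q × v p ≡ 1ℤ
one-before (step {s′ = s′} eq π) {zero} v₀ rewrite v₀ with s′ | eq
... | true  | ()
... | false | ()
one-before (step {s′ = true} eq π) {suc q} vq =
  zero , z<s , trans (sym (ℤ.+-identityˡ _)) eq
one-before (step {s′ = false} eq π) {suc q} vq with one-before π vq
... | p , p<q , vp = suc p , s<s p<q , vp

-- After the -1 the path is at 0 and still has to end at 1. The start `s` is arbitrary so that the
-- induction can pass over earlier entries.
one-after : ∀ {n s} {v : Vector ℤ n} → Path s v true → ∀ {q} → v q ≡ -1ℤ →
  ∃[ p ] q < p × v p ≡ 1ℤ
one-after {s = s} (step {s′ = s′} eq π) {zero} v₀ rewrite v₀ with s | s′ | eq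
... | true  | false | _ with path-one π
...   | p , vp = suc p , z<s , vp
one-after (step _ _) {zero} _ | true  | true  | ()
one-after (step _ _) {zero} _ | false | true  | ()
one-after (step _ _) {zero} _ | false | false | ()
one-after (step eq π) {suc q} vq with one-after π vq
... | p , q<p , vp = suc p , s<s q<p , vp

-- Alternating signs give paths.

Entries : ∀ {n} → Vector ℤ n → Set
Entries v = ∀ q → v q ≡ 0ℤ ⊎ v q ≡ 1ℤ ⊎ v q ≡ -1ℤ

nonzeros : ∀ {n} → Vector ℤ n → List ℤ
nonzeros v = filter (λ x → ¬? (x ℤ.≟ 0ℤ)) (toList v)

-- The value of the nonzero entry that leads to the running sum ⟦ s ⟧.
lastNonzero : Bool → ℤ
lastNonzero s = if s then 1ℤ else -1ℤ

-- The virtual head `lastNonzero s` remembers the state: the next nonzero entry must have the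
-- opposite sign, hence moves the running sum to the other bit.
linked⇒path : ∀ {n} s (v : Vector ℤ n) → Entries v →
  Linked (λ x y → sign x ≢ sign y) (lastNonzero s ∷ nonzeros v) →
  ∃[ t ] Path s v t
linked⇒path {zero} s v en l = s , done
linked⇒path {suc n} s v en l with v zero in eq | en zero
... | _ | inj₁ refl with linked⇒path s (tail v) (en ∘ suc) l
...   | t , π = t , step (trans (cong (⟦ s ⟧ +_) eq) (ℤ.+-identityʳ ⟦ s ⟧)) π
linked⇒path {suc n} true v en (r ∷ l) | _ | inj₂ (inj₁ refl) = contradiction refl r
linked⇒path {suc n} false v en (r ∷ l) | _ | inj₂ (inj₁ refl)
  with linked⇒path true (tail v) (en ∘ suc) l
... | t , π = t , step (cong (0ℤ +_) eq) π
linked⇒path {suc n} true v en (r ∷ l) | _ | inj₂ (inj₂ refl)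
  with linked⇒path false (tail v) (en ∘ suc) l
... | t , π = t , step (cong (1ℤ +_) eq) π
linked⇒path {suc n} false v en (r ∷ l) | _ | inj₂ (inj₂ refl) = contradiction refl r

-- The first nonzero entry dictates the start: 0 before a 1, 1 before a -1. If there is none, the
-- start defaults to 0.
alternating⇒path : ∀ {n} (v : Vector ℤ n) → Entries v → Alternating v →
  ∃[ s ] ∃[ t ] Path s v t
alternating⇒path {zero} v en l = false , false , done
alternating⇒path {suc n} v en l with v zero in eq | en zero
... | _ | inj₁ refl with alternating⇒path (tail v) (en ∘ suc) l
...   | s , t , π = s , t , step (trans (cong (⟦ s ⟧ +_) eq) (ℤ.+-identityʳ ⟦ s ⟧)) π
alternating⇒path {suc n} v en l | _ | inj₂ (inj₁ refl)
  with linked⇒path true (tail v) (en ∘ suc) l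
... | t , π = false , t , step (cong (0ℤ +_) eq) π
alternating⇒path {suc n} v en l | _ | inj₂ (inj₂ refl)
  with linked⇒path false (tail v) (en ∘ suc) l
... | t , π = true , t , step (cong (1ℤ +_) eq) π

-- Two bits that differ by the sum 1 can only be 0 at the start and 1 at the end.
sum-one⇒path : ∀ {n} (v : Vector ℤ n) → Entries v → Alternating v → sum v ≡ 1ℤ →
  Path false v true
sum-one⇒path v en al eq with alternating⇒path v en al
... | s , t , π with path-sum π
...   | e rewrite eq with s | t | e
...     | false | true  | _ = π
...     | false | false | ()
...     | true  | true  | ()
...     | true  | false | ()

-- Standard basis vectors and permutation matrices.

IsUnit : ∀ {n} → Vector ℤ n → Fin n → Set
IsUnit v k = ∀ q → v q ≡ ⟦ does (k ≟ q) ⟧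

nonnegative-path-zero : ∀ {n t} {v : Vector ℤ n} → Path true v t →
  (∀ q → v q ≢ -1ℤ) → ∀ q → v q ≡ 0ℤ
nonnegative-path-zero (step {s′ = true} eq π) nn zero =
  ∙-cancelˡ 1ℤ _ _ eq
nonnegative-path-zero (step {s′ = true} eq π) nn (suc q) =
  nonnegative-path-zero π (nn ∘ suc) q
nonnegative-path-zero (step {s′ = false} eq π) nn q =
  contradiction (∙-cancelˡ 1ℤ _ _ eq) (nn zero)

-- The first step away from 0 locates the 1; from then on the path can neither rise nor, without a
-- -1, fall.
nonnegative-path-unit : ∀ {n} {v : Vector ℤ n} → Path false v true →
  (∀ q → v q ≢ -1ℤ) → ∃[ k ] IsUnit v k
nonnegative-path-unit {v = v} (step {s′ = true} eq π) nn = zero , λ where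
  zero    → trans (sym (ℤ.+-identityˡ _)) eq
  (suc q) → nonnegative-path-zero π (nn ∘ suc) q
nonnegative-path-unit {v = v} (step {s′ = false} eq π) nn
  with nonnegative-path-unit π (nn ∘ suc)
... | k , u = suc k , λ where
  zero    → trans (sym (ℤ.+-identityˡ _)) eq
  (suc q) → u q

unit-self : ∀ {n} {v : Vector ℤ n} k → IsUnit v k → v k ≡ 1ℤ
unit-self k u = trans (u k) (cong ⟦_⟧ (dec-true (k ≟ k) refl))

unit-unique : ∀ {n} {v : Vector ℤ n} k {q} → IsUnit v k → v q ≡ 1ℤ → k ≡ q
unit-unique k {q} u eq with k ≟ q | u q
... | yes k≡q | _ = k≡q
... | no  _   | e = contradiction (trans (sym e) eq) λ ()

sum-zero : ∀ {n} (v : Vector ℤ n) → (∀ q → v q ≡ 0ℤ) → sum v ≡ 0ℤ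
sum-zero {n} v z = trans (sum-cong-≗ z) (sum-replicate-zero n)

unit-sum : ∀ {n} (v : Vector ℤ n) k → IsUnit v k → sum v ≡ 1ℤ
unit-sum v zero    u = cong₂ _+_ (u zero) (sum-zero (tail v) (u ∘ suc))
unit-sum v (suc k) u = cong₂ _+_ (u zero) (unit-sum (tail v) k (u ∘ suc))

unit-prefix-≤ : ∀ {n} (v : Vector ℤ n) k {j} → IsUnit v k → k ≤ j →
  prefix v (suc j) ≡ 1ℤ
unit-prefix-≤ v zero {j} u _ =
  cong₂ _+_ (u zero) (sum-zero {toℕ j} _ λ q → u (suc (inject! q)))
unit-prefix-≤ v (suc k) {suc j} u (s≤s k≤j) =
  cong₂ _+_ (u zero) (unit-prefix-≤ (tail v) k (u ∘ suc) k≤j)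

unit-prefix-> : ∀ {n} (v : Vector ℤ n) k {j} → IsUnit v k → j < k →
  prefix v (suc j) ≡ 0ℤ
unit-prefix-> v (suc k) {zero}  u _ = cong (_+ 0ℤ) (u zero)
unit-prefix-> v (suc k) {suc j} u (s≤s j<k) =
  cong₂ _+_ (u zero) (unit-prefix-> (tail v) k (u ∘ suc) j<k)

nonzeros-zero : ∀ {n} (v : Vector ℤ n) → (∀ q → v q ≡ 0ℤ) → nonzeros v ≡ []
nonzeros-zero {zero}  v z = refl
nonzeros-zero {suc n} v z rewrite z zero = nonzeros-zero (tail v) (z ∘ suc)

nonzeros-unit : ∀ {n} (v : Vector ℤ n) k → IsUnit v k → nonzeros v ≡ 1ℤ ∷ []
nonzeros-unit v zero u rewrite u zero =
  cong (1ℤ ∷_) (nonzeros-zero (tail v) (u ∘ suc))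
nonzeros-unit v (suc k) u rewrite u zero = nonzeros-unit (tail v) k (u ∘ suc)

unit-alternating : ∀ {n} (v : Vector ℤ n) k → IsUnit v k → Alternating v
unit-alternating v k u = subst (Linked _) (sym (nonzeros-unit v k u)) [-]

permutationMatrix-column : ∀ {n} (w : Permutation′ n) q →
  IsUnit (transpose (permutationMatrix w) q) (w ⟨$⟩ˡ q)
permutationMatrix-column w q p = cong ⟦_⟧ (does-⇔
  (mk⇔ (λ eq → trans (cong (w ⟨$⟩ˡ_) (sym eq)) (inverseˡ w))
       (λ eq → trans (cong (w ⟨$⟩ʳ_) (sym eq)) (inverseʳ w)))
  (w ⟨$⟩ʳ p ≟ q) (w ⟨$⟩ˡ q ≟ p))

unit-entries : ∀ {n} {v : Vector ℤ n} k → IsUnit v k → Entries v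
unit-entries k u q with does (k ≟ q) | u q
... | false | eq = inj₁ eq
... | true  | eq = inj₂ (inj₁ eq)

permutationMatrix-isASM : ∀ {n} {A : SquareMatrix n} (w : Permutation′ n) →
  A ≈ᴹ permutationMatrix w → IsASM A
permutationMatrix-isASM {A = A} w A≈ = record
  { entries     = λ p → unit-entries (w ⟨$⟩ʳ p) (A≈ p)
  ; rows-alt    = λ p → unit-alternating (A p) (w ⟨$⟩ʳ p) (A≈ p)
  ; columns-alt = λ q → unit-alternating (transpose A q) (w ⟨$⟩ˡ q) (column q)
  ; rows-sum    = λ p → unit-sum (A p) (w ⟨$⟩ʳ p) (A≈ p)
  ; columns-sum = λ q → unit-sum (transpose A q) (w ⟨$⟩ˡ q) (column q)
  }
  where
  column : ∀ q → IsUnit (transpose A q) (w ⟨$⟩ˡ q)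
  column q p = trans (A≈ p q) (permutationMatrix-column w q p)

-- Alternating sign matrices without -1.

module _ {n} {A : SquareMatrix n} (asm : IsASM A) where
  open IsASM asm

  row-path : ∀ p → Path false (A p) true
  row-path p = sum-one⇒path (A p) (entries p) (rows-alt p) (rows-sum p)

  column-path : ∀ q → Path false (transpose A q) true
  column-path q = sum-one⇒path (transpose A q) (λ p → entries p q)
    (columns-alt q) (columns-sum q)

-- Sending a row to the column of its only 1, and a column to the row of its only 1, are mutually
-- inverse: a 1 at (p, q) is the only one in both its row and its column.
nonnegative-asm : ∀ {n} {A : SquareMatrix n} → IsASM A →
  (∀ p q → A p q ≢ -1ℤ) → ∃[ w ] A ≈ᴹ permutationMatrix w
nonnegative-asm {n} {A} asm nn =
  permutation (proj₁ ∘ row) (proj₁ ∘ column)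
    (λ q → unit-unique _ (proj₂ (row _)) (unit-self _ (proj₂ (column q))))
    (λ p → unit-unique _ (proj₂ (column _)) (unit-self _ (proj₂ (row p)))) ,
  proj₂ ∘ row
  where
  row : ∀ p → ∃[ k ] IsUnit (A p) k
  row p = nonnegative-path-unit (row-path asm p) (nn p)
  column : ∀ q → ∃[ k ] IsUnit (transpose A q) k
  column q = nonnegative-path-unit (column-path asm q) λ p → nn p q

-- The rank condition in terms of adjacent rows.

rank-suc : ∀ {n} (A : SquareMatrix n) p j →
  rank A (suc p) j ≡ rank A (inject₁ p) j + prefix (A p) j
-- By definition `rank A _ j` is itself the `prefix` of the vector of row prefix sums.
rank-suc A p j = prefix-suc (λ p → prefix (A p) j) p

-- This is what remains of `RankCondition` once the common rank is cancelled. In an ASM it forbids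
-- exactly a prefix sum 0 in one row with 1 in the next.
RowCondition : ∀ {m} → SquareMatrix (suc m) → Fin m → Set
RowCondition {m} A i = ∀ (j : Fin (suc m)) →
  prefix (A (inject₁ i)) (suc j) ≡ 1ℤ ⊎ prefix (A (suc i)) (suc j) ≡ 0ℤ

RankCondition : ∀ {m} → SquareMatrix (suc m) → Fin m → Set
RankCondition {m} A i = ∀ (j : Fin (suc m)) →
    rank A (suc (inject₁ i)) (suc j) ≡ rank A (inject₁ (inject₁ i)) (suc j) + 1ℤ
  ⊎ rank A (suc (inject₁ i)) (suc j) ≡ rank A (suc (suc i)) (suc j)

rank⇒row : ∀ {m} (A : SquareMatrix (suc m)) {i} →
  RankCondition A i → RowCondition A i
rank⇒row A {i} rc j with rc j
... | inj₁ eq = inj₁ (∙-cancelˡ (rank A (inject₁ (inject₁ i)) (suc j))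
  (prefix (A (inject₁ i)) (suc j)) 1ℤ
  (trans (sym (rank-suc A (inject₁ i) (suc j))) eq))
... | inj₂ eq = inj₂ (∙-cancelˡ (rank A (suc (inject₁ i)) (suc j))
  (prefix (A (suc i)) (suc j)) 0ℤ
  (trans (sym (rank-suc A (suc i) (suc j))) (trans (sym eq) (sym (ℤ.+-identityʳ _)))))

row⇒rank : ∀ {m} (A : SquareMatrix (suc m)) {i} →
  RowCondition A i → RankCondition A i
row⇒rank A {i} rc j with rc j
... | inj₁ eq = inj₁ (trans (rank-suc A (inject₁ i) (suc j))
  (cong (rank A (inject₁ (inject₁ i)) (suc j) +_) eq))
... | inj₂ eq = inj₂ (sym (trans (rank-suc A (suc i) (suc j))
  (trans (cong (rank A (suc (inject₁ i)) (suc j) +_) eq) (ℤ.+-identityʳ _))))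

zero-persists : ∀ {m} (A : SquareMatrix (suc m)) {p p′} j → p ≤ p′ →
  (∀ i → p ≤ inject₁ i → suc i ≤ p′ → RowCondition A i) →
  prefix (A p) j ≡ 0ℤ → prefix (A p′) j ≡ 0ℤ
zero-persists A zero p≤p′ rc eq = refl
zero-persists {m} A {p} {p′} (suc j) p≤p′ rc eq = proj₂
  (<-weakInduction-startingFrom Q (ℕ.≤-refl , λ _ → eq) advance p≤p′) ℕ.≤-refl
  where
  -- The bound `r ≤ p′` is a premise inside `Q`, so the induction may run over all rows from `p` on
  -- while using the row condition only up to `p′`.
  Q : Fin (suc m) → Set
  Q r = p ≤ r × (r ≤ p′ → prefix (A r) (suc j) ≡ 0ℤ)
  advance : ∀ i → Q (inject₁ i) → Q (suc i)
  advance i (p≤i , z) = ℕ.≤-trans p≤i i≤si , λ si≤p′ →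
    [ (λ o → contradiction (trans (sym o) (z (ℕ.≤-trans i≤si si≤p′))) λ ())
    , id ]′ (rc i p≤i si≤p′ j)
    where
    i≤si : inject₁ i ≤ suc i
    i≤si = ℕ.<⇒≤ (≤̄⇒inject₁< {i = i} ℕ.≤-refl)

-- The single missing index and the exclusion of -1.

-- Past the first `outside`, the cardinality equals the number of remaining positions, so the rest
-- is the full set.
one-missing : ∀ {m} (I : Subset (suc m)) → ∣ I ∣ ≡ m →
  ∃[ k ] ∀ i → i ≢ k → i ∈ I
one-missing (outside ∷ I) eq = zero , λ where
  zero    i≢k → contradiction refl i≢k
  (suc i) _   → there (subst (i ∈_) (sym (∣p∣≡n⇒p≡⊤ eq)) ∈⊤)
one-missing {suc m} (inside ∷ I) eq with one-missing I (ℕ.suc-injective eq)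
... | k , full = suc k , λ where
  zero    _   → here
  (suc i) i≢k → there (full i (i≢k ∘ cong suc))

no-negative : ∀ {m} {A : SquareMatrix (suc m)} → IsASM A →
  ∀ k → (∀ i → i ≢ k → RowCondition A i) → ∀ p q → A p q ≢ -1ℤ
no-negative {m} {A} asm k rc p q neg with toℕ p ℕ.≤? toℕ k
... | yes p≤k with one-before (column-path asm q) neg
...   | p′ , p′<p , one = contradiction
  (trans (sym (proj₁ (path-fall (row-path asm p) neg)))
    -- The sum strictly before column q is 0 in front of a 1 and 1 in front of a -1.
    (zero-persists A (inject₁ q) (ℕ.<⇒≤ p′<p) rc′
      (proj₁ (path-rise (row-path asm p′) one))))
  λ ()
  where
  rc′ : ∀ i → p′ ≤ inject₁ i → suc i ≤ p → RowCondition A i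
  -- Steps that end at or above row `p` have index below `p`, hence below `k`.
  rc′ i _ i<p = rc i λ i≡k →
    ℕ.<⇒≢ (ℕ.<-≤-trans i<p p≤k) (cong toℕ i≡k)
no-negative {m} {A} asm k rc p q neg | no p≰k
  with one-after (column-path asm q) neg
... | p′ , p<p′ , one = contradiction
  (trans (sym (proj₂ (path-rise (row-path asm p′) one)))
    -- Here column q is included: the sum is 0 after the -1 and 1 after the later 1.
    (zero-persists A (suc q) (ℕ.<⇒≤ p<p′) rc′
      (proj₂ (path-fall (row-path asm p) neg))))
  λ ()
  where
  rc′ : ∀ i → p ≤ inject₁ i → suc i ≤ p′ → RowCondition A i
  rc′ i p≤i _ = rc i λ i≡k → p≰k
    (ℕ.≤-trans p≤i (ℕ.≤-reflexive (trans (toℕ-inject₁ i) (cong toℕ i≡k))))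

-- Ascents of a permutation and the row condition.

module _ {m} {A : SquareMatrix (suc m)} (w : Permutation′ (suc m))
         (A≈ : A ≈ᴹ permutationMatrix w) (i : Fin m) where

  -- Test the condition at the column of the 1 in row `suc i`: there the prefix sum of that row is
  -- already 1, so row `inject₁ i` must have met its own 1. Injectivity of `w` makes the inequality
  -- strict.
  row-condition⇒ascent :
    RowCondition A i → w ⟨$⟩ʳ inject₁ i < w ⟨$⟩ʳ suc i
  row-condition⇒ascent rc = ℕ.≰⇒> λ wsi≤wi →
    let wsi<wi = Fin.≤∧≢⇒< wsi≤wi λ eq →
          Fin.<⇒≢ (≤̄⇒inject₁< {i = i} ℕ.≤-refl) (sym (Injection.injective (↔⇒↣ w) eq))
    in [ (λ one → contradiction (trans (sym one)
           (unit-prefix-> (A (inject₁ i)) (w ⟨$⟩ʳ inject₁ i) (A≈ _) wsi<wi))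
           λ ())
       , (λ zer → contradiction (trans (sym zer)
           (unit-prefix-≤ (A (suc i)) (w ⟨$⟩ʳ suc i) (A≈ _)
             (Fin.≤-refl {x = w ⟨$⟩ʳ suc i})))
           λ ())
       ]′ (rc (w ⟨$⟩ʳ suc i))

  -- At column `j` either the upper row has reached its 1, or the lower row, whose 1 lies further
  -- right, has not.
  ascent⇒row-condition :
    w ⟨$⟩ʳ inject₁ i < w ⟨$⟩ʳ suc i → RowCondition A i
  ascent⇒row-condition wi<wsi j with toℕ (w ⟨$⟩ʳ inject₁ i) ℕ.≤? toℕ j
  ... | yes wi≤j = inj₁ (unit-prefix-≤ (A (inject₁ i)) (w ⟨$⟩ʳ inject₁ i) (A≈ _)
                          wi≤j)
  ... | no  wi≰j = inj₂ (unit-prefix-> (A (suc i)) (w ⟨$⟩ʳ suc i) (A≈ _)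
                          (ℕ.<-trans (ℕ.≰⇒> wi≰j) wi<wsi))

proposition4p2 : ∀ (m : ℕ) (I : Subset (suc m)) → ∣ I ∣ ≡ m →
    ∀ (A : SquareMatrix (suc (suc m))) →
    (A ∈ASM^ I) ⇔ (∃[ w ] (w ∈S^ I × A ≈ᴹ permutationMatrix w))
proposition4p2 m I ∣I∣≡m A = mk⇔ to from
  where
  to : A ∈ASM^ I → ∃[ w ] (w ∈S^ I × A ≈ᴹ permutationMatrix w)
  to (asm , rc) with one-missing I ∣I∣≡m
  ... | k , i∈I with nonnegative-asm asm
        (no-negative asm k λ i i≢k → rank⇒row A (rc i (i∈I i i≢k)))
  ...   | w , A≈ =
    w , (λ i i∈ → row-condition⇒ascent w A≈ i (rank⇒row A (rc i i∈))) , A≈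
  from : ∃[ w ] (w ∈S^ I × A ≈ᴹ permutationMatrix w) → A ∈ASM^ I
  from (w , asc , A≈) = permutationMatrix-isASM w A≈ ,
    λ i i∈ → row⇒rank A (ascent⇒row-condition w A≈ i (asc i i∈))
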